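{- Let $G$ be a $P_7$-free graph and let $S$ be a minimal separator in $G$. Then there exists a set $S' \subseteq V(G)$ with $|S'| \leq 22$ such that $S \subseteq N_G[S']$.
   Context: All graphs are finite and simple. $P_t$ denotes the path on $t$ vertices; a graph is $P_t$-free if it has no induced subgraph isomorphic to $P_t$. For $X\subseteq V(G)$, $N_G(X)$ is the set of vertices outside $X$ adjacent to some vertex of $X$, and $N_G[X] = X \cup N_G(X)$ is the closed neighborhood. For $S \subseteq V(G)$, a connected component $A$ of $G - S$ is a full component of $S$ if $N_G(A) = S$. A set $S \subseteq V(G)$ is a minimal separator if $G-S$ has at least two full components of $S$. -}

module Defs where

open import Data.Nat using (ℕ; suc; _+_)
open import Data.Fin using (Fin; toℕ)
open import Data.Fin.Subset using (Subset; _∈_; _∉_; _⊆_)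
open import Data.Product using (Σ; ∃; _×_; _,_)
open import Data.Sum using (_⊎_)
open import Data.Empty using (⊥)
open import Relation.Nullary using (¬_; Dec)
open import Relation.Binary.PropositionalEquality using (_≡_)
open import Function.Bundles using (_⇔_)
open import Function.Definitions using (Injective)

record Graph (n : ℕ) : Set₁ where
  field
    Adj     : Fin n → Fin n → Set
    Adj?    : ∀ u v → Dec (Adj u v)
    sym     : ∀ {u v} → Adj u v → Adj v u
    irrefl  : ∀ {u} → ¬ Adj u u

open Graph public

Consecutive : ∀ {t} → Fin t → Fin t → Set
Consecutive i j = (suc (toℕ i) ≡ toℕ j) ⊎ (suc (toℕ j) ≡ toℕ i)

record InducedPath {n} (G : Graph n) (t : ℕ) : Set where
  field
    f      : Fin t → Fin n
    inj    : Injective _≡_ _≡_ f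
    edges  : ∀ i j → (Adj G (f i) (f j) ⇔ Consecutive i j)

PFree : ∀ {n} → ℕ → Graph n → Set
PFree t G = ¬ InducedPath G t

InN : ∀ {n} → Graph n → Subset n → Fin n → Set
InN G X v = v ∉ X × ∃ λ u → u ∈ X × Adj G u v

InNClosed : ∀ {n} → Graph n → Subset n → Fin n → Set
InNClosed G X v = v ∈ X ⊎ InN G X v

data ReachIn {n} (G : Graph n) (A : Subset n) : Fin n → Fin n → Set where
  here  : ∀ {u} → u ∈ A → ReachIn G A u u
  step  : ∀ {u w v} → u ∈ A → Adj G u w → ReachIn G A w v → ReachIn G A u v

record IsComponent {n} (G : Graph n) (S A : Subset n) : Set where
  field
    nonempty  : ∃ λ v → v ∈ A
    avoidS    : ∀ v → v ∈ A → v ∉ S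
    connected : ∀ u v → u ∈ A → v ∈ A → ReachIn G A u v
    maximal   : ∀ u v → u ∈ A → Adj G u v → v ∉ S → v ∈ A

record IsFullComponent {n} (G : Graph n) (S A : Subset n) : Set where
  field
    component : IsComponent G S A
    full      : ∀ v → (InN G A v ⇔ v ∈ S)

MinimalSeparator : ∀ {n} → Graph n → Subset n → Set
MinimalSeparator G S =
  Σ (Subset _) λ A → Σ (Subset _) λ B →
    IsFullComponent G S A × IsFullComponent G S B × ¬ (A ≡ B)

-- Let A and B be full components of S. By P₇-freeness no vertex of S starts an induced P₄ into both
-- A and B. Two vertices p, q of A can be chosen so that every v ∈ S without a P₄ into A that misses
-- p and q has N_A(v) complete to A ∖ N(v); likewise for B. This costs 4 vertices. If such vertices
-- u and v have incomparable neighbourhoods in A and v misses u and some a ∈ N_A(u) ∖ N(v), then they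
-- are joined by a P₄ through A. Hence the vertices with a P₄ into B are dominated by 5 vertices
-- taken around one with minimal N_A, and symmetrically for A. For the vertices with complete
-- splits on both sides, a path v a′ a u b b′ w with a, a′ ∈ A and b, b′ ∈ B is excluded, and applying
-- this to suitably minimal u and v shows that 8 vertices suffice: 22 = 4 + 5 + 5 + 8.
-- Existence of minimal objects is used under double negation, the conclusion being decidable.

module Submission where

open import Defs
open import Data.Nat using (ℕ; _≤_)
open import Data.Fin.Subset using (Subset; _∈_; ∣_∣)
open import Data.Product using (Σ; _×_)

open import Data.Empty using (⊥-elim)
open import Data.Fin using (Fin; zero; suc)
open import Data.Fin.Properties using (all?; any?) renaming (_≟_ to _≟ᶠ_)
open import Data.Fin.Subset using (_∉_; _⊆_; _⊂_; _⊃_; _∩_; _∪_; _─_; ⁅_⁆; inside; outside) renaming (⊥ to ∅)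
open import Data.Fin.Subset.Induction using (⊂-wellFounded; ⊃-wellFounded)
open import Data.Fin.Subset.Properties
  using (_∈?_; ∣⊥∣≡0; x∈⁅x⁆; x∈⁅y⁆⇒x≡y; ∣⁅x⁆∣≡1; ⊆-antisym; x∈p∩q⁺; x∈p∩q⁻; x∈p∪q⁺; x∈p∪q⁻; p⊆p∪q;
         p─q⊆p; x∈p∧x∉q⇒x∈p─q; anySubset?)
open import Data.List.Base using (List; []; _∷_; _++_; length; foldr)
open import Data.List.Properties using (length-++)
open import Data.List.Relation.Unary.Any as Any using (Any; here; there)
open import Data.List.Relation.Unary.Any.Properties using (++⁺ˡ; ++⁺ʳ)
open import Data.Nat using (_+_; z≤n; s≤s)
open import Data.Nat.Properties using (≤-refl; ≤-trans; ≤-reflexive; +-mono-≤; +-suc; suc-injective; m≤n⇒m≤1+n; _≟_; _≤?_)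
open import Data.Product using (∃; _,_; proj₁; proj₂)
open import Data.Sum as Sum using (inj₁; inj₂; [_,_]′)
open import Data.Unit using (⊤; tt)
open import Data.Vec.Base as Vec using (Vec; lookup; tabulate)
open import Data.Vec.Properties using (lookup∘tabulate; []=⇒lookup; lookup⇒[]=)
open import Data.Vec.Relation.Unary.All using (All; []; _∷_)
open import Data.Vec.Relation.Unary.All.Properties using (lookup⁺)
open import Function.Base using (_∘_)
open import Function.Bundles using (Equivalence; mk⇔)
open import Induction.WellFounded using (WellFounded; Acc; acc)
open import Level using (0ℓ)
open import Relation.Binary.Core using (Rel)
open import Relation.Binary.PropositionalEquality using (_≡_; refl; cong; subst; trans) renaming (sym to ≡-sym)
open import Relation.Nullary using (¬_; Dec; yes; no; contradiction)
open import Relation.Nullary.Decidable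
  using (does; decidable-stable; toWitness; _×-dec_; _⊎-dec_; _→-dec_; ¬?; ¬¬-excluded-middle; dec-true; dec-false)
open import Relation.Nullary.Negation using (DoubleNegation)

-- Minimal elements, witnesses and finite subsets

minimal-exists : ∀ {X Y : Set} {_<_ : Rel Y 0ℓ} → WellFounded _<_ → (μ : X → Y) → X →
                 DoubleNegation (Σ X λ x → ∀ y → ¬ μ y < μ x)
minimal-exists {X} {_<_ = _<_} wf μ x none = descend x (wf (μ x))
  where
  descend : ∀ x → Acc _<_ (μ x) → _
  descend x (acc rs) = none (x , λ y y<x → descend y (rs y<x))

⊈-witness : ∀ {n} {p q : Subset n} → ¬ p ⊆ q → ∃ λ x → x ∈ p × x ∉ q
⊈-witness {p = p} {q} p⊈q with any? (λ x → (x ∈? p) ×-dec ¬? (x ∈? q))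
... | yes found = found
... | no none = contradiction (λ {x} x∈p → decidable-stable (x ∈? q) λ x∉q → none (x , x∈p , x∉q)) p⊈q

x∈p─q⇒x∉q : ∀ {n} {x : Fin n} (p q : Subset n) → x ∈ p ─ q → x ∉ q
x∈p─q⇒x∉q (_ Vec.∷ p) (_ Vec.∷ q) (Vec.there x∈) (Vec.there x∈q) = x∈p─q⇒x∉q p q x∈ x∈q
x∈p─q⇒x∉q (inside Vec.∷ p) (inside Vec.∷ q) () Vec.here
x∈p─q⇒x∉q (outside Vec.∷ p) (inside Vec.∷ q) () Vec.here

∣p∪q∣≤∣p∣+∣q∣ : ∀ {n} (p q : Subset n) → ∣ p ∪ q ∣ ≤ ∣ p ∣ + ∣ q ∣
∣p∪q∣≤∣p∣+∣q∣ Vec.[] Vec.[] = z≤n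
∣p∪q∣≤∣p∣+∣q∣ (outside Vec.∷ p) (outside Vec.∷ q) = ∣p∪q∣≤∣p∣+∣q∣ p q
∣p∪q∣≤∣p∣+∣q∣ (inside Vec.∷ p) (outside Vec.∷ q) = s≤s (∣p∪q∣≤∣p∣+∣q∣ p q)
∣p∪q∣≤∣p∣+∣q∣ (outside Vec.∷ p) (inside Vec.∷ q) =
  ≤-trans (s≤s (∣p∪q∣≤∣p∣+∣q∣ p q)) (≤-reflexive (≡-sym (+-suc ∣ p ∣ ∣ q ∣)))
∣p∪q∣≤∣p∣+∣q∣ (inside Vec.∷ p) (inside Vec.∷ q) =
  s≤s (≤-trans (m≤n⇒m≤1+n (∣p∪q∣≤∣p∣+∣q∣ p q)) (≤-reflexive (≡-sym (+-suc ∣ p ∣ ∣ q ∣))))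

fromList : ∀ {n} → List (Fin n) → Subset n
fromList = foldr (λ x p → ⁅ x ⁆ ∪ p) ∅

∣fromList∣≤length : ∀ {n} (xs : List (Fin n)) → ∣ fromList xs ∣ ≤ length xs
∣fromList∣≤length {n} [] = ≤-reflexive (∣⊥∣≡0 n)
∣fromList∣≤length (x ∷ xs) =
  ≤-trans (∣p∪q∣≤∣p∣+∣q∣ ⁅ x ⁆ (fromList xs)) (+-mono-≤ (≤-reflexive (∣⁅x⁆∣≡1 x)) (∣fromList∣≤length xs))

Any⇒∈fromList : ∀ {n} {P : Fin n → Set} (xs : List (Fin n)) → Any P xs → ∃ λ x → x ∈ fromList xs × P x
Any⇒∈fromList (x ∷ xs) (here px) = x , x∈p∪q⁺ (inj₁ (x∈⁅x⁆ x)) , px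
Any⇒∈fromList (x ∷ xs) (there pxs) with Any⇒∈fromList xs pxs
... | y , y∈ , py = y , x∈p∪q⁺ {p = ⁅ x ⁆} (inj₂ y∈) , py

-- Induced paths listed as vectors

Consecutive? : ∀ {t} (i j : Fin t) → Dec (Consecutive i j)
Consecutive? i j = (_ ≟ _) ⊎-dec (_ ≟ _)

-- Checked on all pairs of positions. It yields the injectivity of a path from its adjacencies
-- alone.
P₇-twin-free : ∀ (i j : Fin 7) → (∀ k → Consecutive i k → Consecutive j k) →
               (∀ k → Consecutive j k → Consecutive i k) → i ≡ j
P₇-twin-free = toWitness {a? = all? λ i → all? λ j →
  all? (λ k → Consecutive? i k →-dec Consecutive? j k) →-dec
  all? (λ k → Consecutive? j k →-dec Consecutive? i k) →-dec (i ≟ᶠ j)} tt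

module _ {n} (G : Graph n) where

  infix 4 _~_
  _~_ : Fin n → Fin n → Set
  _~_ = Adj G

  _~?_ : ∀ u v → Dec (u ~ v)
  _~?_ = Adj? G

  ≁-sym : ∀ {u v} → ¬ u ~ v → ¬ v ~ u
  ≁-sym u≁v v~u = u≁v (sym G v~u)

  IsInducedPath : ∀ {t} → Vec (Fin n) t → Set
  IsInducedPath Vec.[] = ⊤
  IsInducedPath (x Vec.∷ Vec.[]) = ⊤
  IsInducedPath (x Vec.∷ y Vec.∷ xs) = x ~ y × All (λ z → ¬ x ~ z) xs × IsInducedPath (y Vec.∷ xs)

  ~⇒Consecutive : ∀ {t} (xs : Vec (Fin n) t) → IsInducedPath xs →
                  ∀ i j → lookup xs i ~ lookup xs j → Consecutive i j
  ~⇒Consecutive (x Vec.∷ xs) p zero zero e = contradiction e (irrefl G)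
  ~⇒Consecutive (x Vec.∷ y Vec.∷ xs) p zero (suc zero) e = inj₁ refl
  ~⇒Consecutive (x Vec.∷ y Vec.∷ xs) p (suc zero) zero e = inj₂ refl
  ~⇒Consecutive (x Vec.∷ y Vec.∷ xs) (_ , x≁ , _) zero (suc (suc j)) e = contradiction e (lookup⁺ x≁ j)
  ~⇒Consecutive (x Vec.∷ y Vec.∷ xs) (_ , x≁ , _) (suc (suc i)) zero e = contradiction (sym G e) (lookup⁺ x≁ i)
  ~⇒Consecutive (x Vec.∷ y Vec.∷ xs) (_ , _ , p) (suc i) (suc j) e =
    Sum.map (cong ℕ.suc) (cong ℕ.suc) (~⇒Consecutive (y Vec.∷ xs) p i j e)

  Consecutive⇒~ : ∀ {t} (xs : Vec (Fin n) t) → IsInducedPath xs →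
                  ∀ i j → Consecutive i j → lookup xs i ~ lookup xs j
  Consecutive⇒~ xs p zero zero (inj₁ ())
  Consecutive⇒~ xs p zero zero (inj₂ ())
  Consecutive⇒~ (x Vec.∷ y Vec.∷ xs) (e , _) zero (suc zero) c = e
  Consecutive⇒~ (x Vec.∷ y Vec.∷ xs) (e , _) (suc zero) zero c = sym G e
  Consecutive⇒~ xs p zero (suc (suc j)) (inj₁ ())
  Consecutive⇒~ xs p zero (suc (suc j)) (inj₂ ())
  Consecutive⇒~ xs p (suc (suc i)) zero (inj₁ ())
  Consecutive⇒~ xs p (suc (suc i)) zero (inj₂ ())
  Consecutive⇒~ (x Vec.∷ y Vec.∷ xs) (_ , _ , p) (suc i) (suc j) c =
    Consecutive⇒~ (y Vec.∷ xs) p i j (Sum.map suc-injective suc-injective c)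

  P₇-free⇒no-path : PFree 7 G → (xs : Vec (Fin n) 7) → ¬ IsInducedPath xs
  P₇-free⇒no-path P₇-free xs p = P₇-free record
    { f     = lookup xs
    ; inj   = λ {i} {j} eq → P₇-twin-free i j (same-nbrs eq) (same-nbrs (≡-sym eq))
    ; edges = λ i j → mk⇔ (~⇒Consecutive xs p i j) (Consecutive⇒~ xs p i j)
    }
    where
    same-nbrs : ∀ {i j} → lookup xs i ≡ lookup xs j → ∀ k → Consecutive i k → Consecutive j k
    same-nbrs {i} {j} eq k c = ~⇒Consecutive xs p j k (subst (_~ lookup xs k) eq (Consecutive⇒~ xs p i k c))

  -- Neighbourhoods inside a set, tails and splits

  nbr : Subset n → Fin n → Subset n
  nbr A v = A ∩ tabulate (λ u → does (v ~? u))

  ∈nbr⁺ : ∀ {A v x} → x ∈ A → v ~ x → x ∈ nbr A v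
  ∈nbr⁺ {A} {v} {x} x∈A v~x = x∈p∩q⁺ (x∈A , lookup⇒[]= x _ (trans (lookup∘tabulate _ x) (dec-true (v ~? x) v~x)))

  ∈nbr⁻ : ∀ {A v x} → x ∈ nbr A v → x ∈ A × v ~ x
  ∈nbr⁻ {A} {v} {x} x∈ with x∈p∩q⁻ A _ x∈
  ... | x∈A , x∈N = x∈A , decidable-stable (v ~? x) λ v≁x →
    contradiction (trans (≡-sym ([]=⇒lookup x∈N)) (trans (lookup∘tabulate _ x) (dec-false (v ~? x) v≁x))) λ ()

  nbr-⊈ : ∀ {A v w} → ¬ nbr A v ⊆ nbr A w → ∃ λ a → a ∈ A × v ~ a × ¬ w ~ a
  nbr-⊈ v⊈w with ⊈-witness v⊈w
  ... | a , a∈v , a∉w with ∈nbr⁻ a∈v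
  ... | a∈A , v~a = a , a∈A , v~a , λ w~a → a∉w (∈nbr⁺ a∈A w~a)

  nbr-⊂ : ∀ {A v w a} → nbr A v ⊆ nbr A w → a ∈ A → w ~ a → ¬ v ~ a → nbr A v ⊂ nbr A w
  nbr-⊂ v⊆w a∈A w~a v≁a = v⊆w , _ , ∈nbr⁺ a∈A w~a , λ a∈v → v≁a (proj₂ (∈nbr⁻ a∈v))

  HasNbr : Subset n → Fin n → Set
  HasNbr A v = ∃ λ a → a ∈ A × v ~ a

  record TailP₄ (A : Subset n) (v : Fin n) : Set where
    field
      {x y z}     : Fin n
      x∈A         : x ∈ A
      y∈A         : y ∈ A
      z∈A         : z ∈ A
      v~x         : v ~ x
      x~y         : x ~ y
      y~z         : y ~ z
      v≁y         : ¬ v ~ y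
      v≁z         : ¬ v ~ z
      x≁z         : ¬ x ~ z

  Split : Subset n → Fin n → Set
  Split A v = ∀ {x y} → x ∈ A → y ∈ A → v ~ x → ¬ v ~ y → x ~ y

  -- Modules and split pairs

  IsModule : Subset n → Subset n → Set
  IsModule A C = ∀ {x c d} → x ∈ A → x ∉ C → c ∈ C → d ∈ C → x ~ c → x ~ d

  record ProperModule (A : Subset n) : Set where
    field
      {C}       : Subset n
      C⊆A       : C ⊆ A
      {c r}     : Fin n
      c∈C       : c ∈ C
      r∈A       : r ∈ A
      r∉C       : r ∉ C
      isModule  : IsModule A C

  ConnectedIn : Subset n → Set
  ConnectedIn A = ∀ u v → u ∈ A → v ∈ A → ReachIn G A u v

  leaving-edge : ∀ {A u v} (C : Subset n) → ReachIn G A u v → u ∈ C → v ∉ C → v ∈ A →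
                 ∃ λ p → ∃ λ q → p ∈ C × q ∈ A × q ∉ C × p ~ q
  leaving-edge C (here _) u∈C v∉C v∈A = contradiction u∈C v∉C
  leaving-edge C (step {w = w} u∈A u~w w⇝v) u∈C v∉C v∈A with w ∈? C
  ... | yes w∈C = leaving-edge C w⇝v w∈C v∉C v∈A
  ... | no w∉C = _ , w , u∈C , start w⇝v , w∉C , u~w
    where
    start : ∀ {w v} → ReachIn G _ w v → w ∈ _
    start (here w∈A) = w∈A
    start (step w∈A _ _) = w∈A

  -- Such a `D` is a union of components of A ∖ N(v). With closure in place of reachability, any
  -- smaller closed set contradicts minimality.
  record Closed (A : Subset n) (v q : Fin n) : Set where
    field
      {D}      : Subset n
      q∈D      : q ∈ D
      D⊆A      : D ⊆ A
      v≁D      : ∀ {d} → d ∈ D → ¬ v ~ d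
      closed   : ∀ {d y} → d ∈ D → y ∈ A → ¬ v ~ y → d ~ y → y ∈ D

  -- The component of q in A ∖ N(v) is the minimal closed set; it is a module because any vertex of
  -- N(v) seeing only part of it would start an induced P₄ from v.
  component-module : ∀ {A v q} → ¬ TailP₄ A v → (K : Closed A v q) →
                     (∀ L → ¬ Closed.D {A} {v} {q} L ⊂ Closed.D K) → IsModule A (Closed.D K)
  component-module {A} {v} {q} no-P₄ K min {x} {c} {d} x∈A x∉D c∈D d∈D x~c with v ~? x
  ... | no v≁x = contradiction (closed c∈D x∈A v≁x (sym G x~c)) x∉D
    where open Closed K
  ... | yes v~x = decidable-stable (x ~? d) λ x≁d → by-cases x≁d (x ~? q)
    where
    open Closed K
    -- Otherwise `v x y z` is an induced P₄; so adjacency to `x` spreads along the edges of `D`.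
    no-P₃ : ∀ {y z} → y ∈ D → z ∈ D → x ~ y → y ~ z → x ~ z
    no-P₃ {y} {z} y∈D z∈D x~y y~z = decidable-stable (x ~? z) λ x≁z → no-P₄ record
      { x∈A = x∈A ; y∈A = D⊆A y∈D ; z∈A = D⊆A z∈D ; v~x = v~x ; x~y = x~y ; y~z = y~z
      ; v≁y = v≁D y∈D ; v≁z = v≁D z∈D ; x≁z = x≁z }

    -- Hence D ∩ N(x) and D ∖ N(x) are both closed under adjacency. The one containing `q` is
    -- strictly smaller than `D`: it lacks `d` or `c` respectively.
    by-cases : ¬ x ~ d → ¬ Dec (x ~ q)
    by-cases x≁d (yes x~q) = min
      record
        { q∈D = ∈nbr⁺ q∈D x~q
        ; D⊆A = D⊆A ∘ proj₁ ∘ ∈nbr⁻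
        ; v≁D = v≁D ∘ proj₁ ∘ ∈nbr⁻
        ; closed = λ e∈ y∈A v≁y e~y → let (e∈D , x~e) = ∈nbr⁻ e∈ ; y∈D = closed e∈D y∈A v≁y e~y in
                     ∈nbr⁺ y∈D (no-P₃ e∈D y∈D x~e e~y)
        }
      (proj₁ ∘ ∈nbr⁻ , d , d∈D , λ d∈ → x≁d (proj₂ (∈nbr⁻ d∈)))
    by-cases x≁d (no x≁q) = min
      record
        { q∈D = x∈p∧x∉q⇒x∈p─q q∈D (x≁q ∘ proj₂ ∘ ∈nbr⁻)
        ; D⊆A = D⊆A ∘ p─q⊆p D (nbr D x)
        ; v≁D = v≁D ∘ p─q⊆p D (nbr D x)
        ; closed = λ e∈ y∈A v≁y e~y →
                     let e∈D = p─q⊆p D (nbr D x) e∈ ; y∈D = closed e∈D y∈A v≁y e~y in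
                     x∈p∧x∉q⇒x∈p─q y∈D λ y∈N → x∈p─q⇒x∉q D (nbr D x) e∈
                       (∈nbr⁺ e∈D (no-P₃ y∈D e∈D (proj₂ (∈nbr⁻ y∈N)) (sym G e~y)))
        }
      (p─q⊆p D (nbr D x) , c , c∈D , λ c∈ → x∈p─q⇒x∉q D (nbr D x) c∈ (∈nbr⁺ c∈D x~c))

  IsSplitPair : Subset n → Fin n → Fin n → Set
  IsSplitPair A p q = ∀ v → HasNbr A v → ¬ TailP₄ A v → ¬ v ~ p → ¬ v ~ q → Split A v

  -- For a maximal proper module C, crossed by an edge pq, and a vertex v missing p and q, the
  -- component D of A ∖ N(v) containing p and q is a module meeting C, so C ∪ D = A.
  maximal-module⇒split-pair :
    ∀ {A} (M : ProperModule A) → (∀ M′ → ¬ ProperModule.C {A} M′ ⊃ ProperModule.C M) →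
    ∀ {p q} → p ∈ ProperModule.C M → q ∈ A → q ∉ ProperModule.C M → p ~ q → IsSplitPair A p q
  maximal-module⇒split-pair {A} M max {p} {q} p∈C q∈A q∉C p~q v (a , a∈A , v~a) no-P₄ v≁p v≁q {x} {y} x∈A y∈A v~x v≁y =
    decidable-stable (x ~? y) λ x≁y →
      minimal-exists ⊂-wellFounded Closed.D initial λ (K , min) →
        let open Closed K
            D-module = component-module no-P₄ K min
            p∈D = closed q∈D (C⊆A p∈C) v≁p (sym G p~q)
            E = C ∪ D

            -- Modules sharing `p` have a module as union: an outside vertex seeing either part sees
            -- `p`, hence all of both.
            through-p : ∀ {z e} → z ∈ A → z ∉ E → e ∈ E → z ~ e → z ~ p
            through-p z∈A z∉E e∈E z~e =
              [ (λ e∈C → isModule z∈A (z∉E ∘ x∈p∪q⁺ ∘ inj₁) e∈C p∈C z~e)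
              , (λ e∈D → D-module z∈A (z∉E ∘ x∈p∪q⁺ {p = C} ∘ inj₂) e∈D p∈D z~e)
              ]′ (x∈p∪q⁻ C D e∈E)

            E-module : IsModule A E
            E-module z∈A z∉E d∈E e∈E z~d =
              [ (λ e∈C → isModule z∈A (z∉E ∘ x∈p∪q⁺ ∘ inj₁) p∈C e∈C (through-p z∈A z∉E d∈E z~d))
              , (λ e∈D → D-module z∈A (z∉E ∘ x∈p∪q⁺ {p = C} ∘ inj₂) p∈D e∈D (through-p z∈A z∉E d∈E z~d))
              ]′ (x∈p∪q⁻ C D e∈E)

            C∪D≡A : ∀ {z} → z ∈ A → z ∉ C → z ∈ D
            C∪D≡A {z} z∈A z∉C = decidable-stable (z ∈? D) λ z∉D → max
              record
                { C = E
                ; C⊆A = λ e∈E → [ C⊆A , D⊆A ]′ (x∈p∪q⁻ C D e∈E)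
                ; c∈C = x∈p∪q⁺ (inj₁ p∈C)
                ; r∈A = z∈A
                ; r∉C = λ z∈E → [ z∉C , z∉D ]′ (x∈p∪q⁻ C D z∈E)
                ; isModule = E-module
                }
              (p⊆p∪q D , q , x∈p∪q⁺ {p = C} (inj₂ q∈D) , q∉C)

            C~q : ∀ {z} → z ∈ C → z ~ q
            C~q z∈C = sym G (isModule q∈A q∉C p∈C z∈C (sym G p~q))

            -- `v` sees `x`, so `x` lies in `C` and sees `q`. A `y` outside `D` would lie in `C`,
            -- see `q` and so be in `D` by closure. The module `D` then forces `x ~ y`.
            x∉D = λ x∈D → v≁D x∈D v~x
            x~q = C~q (decidable-stable (x ∈? C) (x∉D ∘ C∪D≡A x∈A))
            y∈D = decidable-stable (y ∈? D) λ y∉D → y∉D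
                    (closed q∈D y∈A v≁y (sym G (C~q (decidable-stable (y ∈? C) (y∉D ∘ C∪D≡A y∈A)))))
        in x≁y (D-module x∈A x∉D q∈D y∈D x~q)
    where
    open ProperModule M

    initial : Closed A v q
    initial = record
      { D = A ─ nbr A v
      ; q∈D = x∈p∧x∉q⇒x∈p─q q∈A (v≁q ∘ proj₂ ∘ ∈nbr⁻)
      ; D⊆A = p─q⊆p A (nbr A v)
      ; v≁D = λ d∈ v~d → x∈p─q⇒x∉q A (nbr A v) d∈ (∈nbr⁺ (p─q⊆p A (nbr A v) d∈) v~d)
      ; closed = λ _ y∈A v≁y _ → x∈p∧x∉q⇒x∈p─q y∈A (v≁y ∘ proj₂ ∘ ∈nbr⁻)
      }

  -- A maximal proper module is left by an edge, as `A` is connected, and its ends serve. Without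
  -- proper modules `A` is just `p`, since `⁅ p ⁆` is a module.
  split-pair-exists : ∀ {A} → ConnectedIn A → ∃ (_∈ A) →
                      DoubleNegation (∃ λ p → ∃ λ q → IsSplitPair A p q)
  split-pair-exists {A} connected (p , p∈A) none = ¬¬-excluded-middle λ where
    (yes M) → minimal-exists ⊃-wellFounded ProperModule.C M λ (M , max) →
      let open ProperModule M
          (p , q , p∈C , q∈A , q∉C , p~q) = leaving-edge C (connected c r (C⊆A c∈C) r∈A) c∈C r∉C r∈A
      in none (p , q , maximal-module⇒split-pair M max p∈C q∈A q∉C p~q)
    (no no-module) → none (p , p , λ v (a , a∈A , v~a) _ v≁p _ → ⊥-elim (no-module record
      { C = ⁅ p ⁆
      ; C⊆A = λ x∈ → subst (_∈ A) (≡-sym (x∈⁅y⁆⇒x≡y p x∈)) p∈A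
      ; c∈C = x∈⁅x⁆ p
      ; r∈A = a∈A
      ; r∉C = λ a∈ → v≁p (subst (v ~_) (x∈⁅y⁆⇒x≡y p a∈) v~a)
      ; isModule = λ {x} _ _ c∈ d∈ x~c → subst (x ~_) (trans (x∈⁅y⁆⇒x≡y p c∈) (≡-sym (x∈⁅y⁆⇒x≡y p d∈))) x~c
      }))

  -- Domination and one-sided vertices

  Dominates : List (Fin n) → Fin n → Set
  Dominates T v = Any (v ~_) T

  -- Domination is by adjacency even for members of the list, so an undominated vertex supplies
  -- non-edges of the forbidden paths.
  Dominated : ℕ → (Fin n → Set) → Set
  Dominated k P = DoubleNegation (Σ (List (Fin n)) λ T → length T ≤ k × (∀ v → P v → Dominates T v))

  -- If `P` is empty the empty list works, so a vertex satisfying `P` may be assumed.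
  dominated-if-inhabited : ∀ {k P} → (∀ v → P v → Dominated k P) → Dominated k P
  dominated-if-inhabited dom none = none ([] , z≤n , λ v pv → ⊥-elim (dom v pv none))

  Anticomplete : Subset n → Subset n → Set
  Anticomplete A B = ∀ {a b} → a ∈ A → b ∈ B → ¬ a ~ b

  OneSided TwoSided : Subset n → Subset n → Fin n → Set
  OneSided A B v = HasNbr A v × Split A v × TailP₄ B v
  TwoSided A B v = (HasNbr A v × Split A v) × (HasNbr B v × Split B v)

  module _ (P₇-free : PFree 7 G) {A B : Subset n} (A≁B : Anticomplete A B) where

    -- Glued at `v`, the two P₄ form an induced P₇.
    not-both-tails : ∀ {v} → TailP₄ A v → ¬ TailP₄ B v
    not-both-tails S T = P₇-free⇒no-path P₇-free
      (S.z Vec.∷ S.y Vec.∷ S.x Vec.∷ _ Vec.∷ T.x Vec.∷ T.y Vec.∷ T.z Vec.∷ Vec.[])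
      ( sym G S.y~z , ≁-sym S.x≁z ∷ ≁-sym S.v≁z ∷ A≁B S.z∈A T.x∈A ∷ A≁B S.z∈A T.y∈A ∷ A≁B S.z∈A T.z∈A ∷ []
      , sym G S.x~y , ≁-sym S.v≁y ∷ A≁B S.y∈A T.x∈A ∷ A≁B S.y∈A T.y∈A ∷ A≁B S.y∈A T.z∈A ∷ []
      , sym G S.v~x , A≁B S.x∈A T.x∈A ∷ A≁B S.x∈A T.y∈A ∷ A≁B S.x∈A T.z∈A ∷ []
      , T.v~x , T.v≁y ∷ T.v≁z ∷ []
      , T.x~y , T.x≁z ∷ []
      , T.y~z , []
      , tt )
      where
      module S = TailP₄ S
      module T = TailP₄ T

    -- For an undominated `v`, minimality of N_A(u) gives `a′` seen by `v` but not by `u`. The split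
    -- at `u` joins it to `a`, and `v a′ a u` continues into the tail of `u` in `B`.
    one-sided-dominated : Dominated 5 (OneSided A B)
    one-sided-dominated = dominated-if-inhabited λ v₀ Pv₀ none →
      minimal-exists {X = ∃ (OneSided A B)} ⊂-wellFounded (nbr A ∘ proj₁) (v₀ , Pv₀) λ
      ((u , (a , a∈A , u~a) , u-split , T) , min) →
        let module T = TailP₄ T in
        none (u ∷ a ∷ T.x ∷ T.y ∷ T.z ∷ [] , ≤-refl , λ v Pv → decidable-stable (Any.any? (v ~?_) _) λ v≁ →
          let v≁u = v≁ ∘ here
              v≁a = v≁ ∘ there ∘ here
              (a′ , a′∈A , v~a′ , u≁a′) = nbr-⊈ λ v⊆u → min (v , Pv) (nbr-⊂ v⊆u a∈A u~a v≁a)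
          in P₇-free⇒no-path P₇-free
            (v Vec.∷ a′ Vec.∷ a Vec.∷ u Vec.∷ T.x Vec.∷ T.y Vec.∷ T.z Vec.∷ Vec.[])
            ( v~a′ , v≁a ∷ v≁u ∷ (v≁ ∘ there ∘ there ∘ here) ∷ (v≁ ∘ there ∘ there ∘ there ∘ here)
                       ∷ (v≁ ∘ there ∘ there ∘ there ∘ there ∘ here) ∷ []
            , sym G (u-split a∈A a′∈A u~a u≁a′)
                   , ≁-sym u≁a′ ∷ A≁B a′∈A T.x∈A ∷ A≁B a′∈A T.y∈A ∷ A≁B a′∈A T.z∈A ∷ []
            , sym G u~a , A≁B a∈A T.x∈A ∷ A≁B a∈A T.y∈A ∷ A≁B a∈A T.z∈A ∷ []
            , T.v~x , T.v≁y ∷ T.v≁z ∷ []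
            , T.x~y , T.x≁z ∷ []
            , T.y~z , []
            , tt ))

    -- Two-sided vertices and good triples

    Private : Subset n → Fin n → Fin n → Fin n → Set
    Private C x y z = ∃ λ c → c ∈ C × x ~ c × ¬ y ~ c × ¬ z ~ c

    no-path-through : ∀ {u v w} → Split A u → Split B u → ¬ v ~ u → ¬ w ~ u → ¬ v ~ w →
      Private A u v w → Private A v u w → Private B u v w → ¬ Private B w u v
    no-path-through {u} {v} {w} splitA splitB v≁u w≁u v≁w
      (a , a∈A , u~a , v≁a , w≁a) (a′ , a′∈A , v~a′ , u≁a′ , w≁a′)
      (b , b∈B , u~b , v≁b , w≁b) (b′ , b′∈B , w~b′ , u≁b′ , v≁b′) = P₇-free⇒no-path P₇-free
      (v Vec.∷ a′ Vec.∷ a Vec.∷ u Vec.∷ b Vec.∷ b′ Vec.∷ w Vec.∷ Vec.[])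
      ( v~a′ , v≁a ∷ v≁u ∷ v≁b ∷ v≁b′ ∷ v≁w ∷ []
      , sym G (splitA a∈A a′∈A u~a u≁a′) , ≁-sym u≁a′ ∷ A≁B a′∈A b∈B ∷ A≁B a′∈A b′∈B ∷ ≁-sym w≁a′ ∷ []
      , sym G u~a , A≁B a∈A b∈B ∷ A≁B a∈A b′∈B ∷ ≁-sym w≁a ∷ []
      , u~b , u≁b′ ∷ ≁-sym w≁u ∷ []
      , splitB b∈B b′∈B u~b u≁b′ , ≁-sym w≁b ∷ []
      , sym G w~b′ , []
      , tt )

    record Triple : Set where
      field
        {u a b}  : Fin n
        u∈Z      : TwoSided A B u
        a∈A      : a ∈ A
        b∈B      : b ∈ B
        u~a      : u ~ a
        u~b      : u ~ b

      record Missed (x : Fin n) : Set where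
        field
          x∈Z  : TwoSided A B x
          x≁u  : ¬ x ~ u
          x≁a  : ¬ x ~ a
          x≁b  : ¬ x ~ b

      -- By contraposition, a missed vertex with a neighbour in B ∖ N(u) also has one in A ∖ N(u).
      Good : Set
      Good = ∀ x → Missed x → nbr A x ⊆ nbr A u → nbr B x ⊆ nbr B u

      no-path : ∀ {v w} → Missed v → Missed w → ¬ v ~ w → Private A v u w → ¬ Private B w u v
      no-path Mv Mw v≁w v-private =
        no-path-through (proj₂ (proj₁ u∈Z)) (proj₂ (proj₂ u∈Z)) (x≁u Mv) (x≁u Mw) v≁w
          (a , a∈A , u~a , x≁a Mv , x≁a Mw) v-private (b , b∈B , u~b , x≁b Mv , x≁b Mw)
        where open Missed

    triple : ∀ {u} → TwoSided A B u → Triple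
    triple u∈Z@(((a , a∈A , u~a) , _) , ((b , b∈B , u~b) , _)) = record
      { u∈Z = u∈Z ; a∈A = a∈A ; b∈B = b∈B ; u~a = u~a ; u~b = u~b }

    -- With N_A(u) minimal, goodness is vacuous: a missed `x` lacks `a`, so N_A(x) cannot lie inside
    -- N_A(u).
    good-triple-exists : ∀ {v} → TwoSided A B v → DoubleNegation (Σ Triple Triple.Good)
    good-triple-exists v∈Z none = minimal-exists {X = ∃ (TwoSided A B)} ⊂-wellFounded (nbr A ∘ proj₁) (_ , v∈Z) λ
      ((u , u∈Z) , min) →
      let t = triple u∈Z
          open Triple t using (a∈A; u~a)
      in none (t , λ x Mx x⊆u → let open Triple.Missed Mx in ⊥-elim (min (x , x∈Z) (nbr-⊂ x⊆u a∈A u~a x≁a)))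

    -- Here every missed vertex has neighbours outside N(u) on both sides.
    module _ (t : Triple) (good : Triple.Good t)
             (no-K : ¬ ∃ λ x → Triple.Missed t x × nbr B x ⊆ nbr B (Triple.u t)) where
      open Triple t
      open Missed

      -- Take a missed `v` with N_A(v) ∖ N(u) minimal. An undominated `x` then has a neighbour `c`
      -- in `A` outside N(u) and N(v), giving the path `x c a u b b′ v`.
      dominated-if-all-leave : Dominated 8 (TwoSided A B)
      dominated-if-all-leave none = ¬¬-excluded-middle λ where
        (no none-missed) → none (u ∷ a ∷ b ∷ [] , s≤s (s≤s (s≤s z≤n)) , λ x x∈Z →
          decidable-stable (Any.any? (x ~?_) _) λ x≁ → none-missed (x , record
            { x∈Z = x∈Z ; x≁u = x≁ ∘ here ; x≁a = x≁ ∘ there ∘ here ; x≁b = x≁ ∘ there ∘ there ∘ here }))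
        (yes missed) → minimal-exists ⊂-wellFounded (nbr (A ─ nbr A u) ∘ proj₁) missed λ ((v , Mv) , min) →
          let (a′ , a′∈A , v~a′ , u≁a′) = nbr-⊈ {A} {v} {u} λ v⊆u → no-K (v , Mv , good v Mv v⊆u)
              (b′ , b′∈B , v~b′ , u≁b′) = nbr-⊈ {B} {v} {u} λ v⊆u → no-K (v , Mv , v⊆u)
          in none (u ∷ a ∷ b ∷ v ∷ a′ ∷ b′ ∷ [] , s≤s (s≤s (s≤s (s≤s (s≤s (s≤s z≤n))))) , λ x x∈Z →
            decidable-stable (Any.any? (x ~?_) _) λ x≁ →
              let Mx = record { x∈Z = x∈Z ; x≁u = x≁ ∘ here ; x≁a = x≁ ∘ there ∘ here ; x≁b = x≁ ∘ there ∘ there ∘ here }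
                  x≁v  = x≁ ∘ there ∘ there ∘ there ∘ here
                  x≁a′ = x≁ ∘ there ∘ there ∘ there ∘ there ∘ here
                  x≁b′ = x≁ ∘ there ∘ there ∘ there ∘ there ∘ there ∘ here
                  (c , c∈ , x~c , v≁c) = nbr-⊈ {A ─ nbr A u} {x} {v} λ x⊆v → min (x , Mx)
                    (nbr-⊂ x⊆v (x∈p∧x∉q⇒x∈p─q a′∈A (u≁a′ ∘ proj₂ ∘ ∈nbr⁻)) v~a′ x≁a′)
                  c∈A = p─q⊆p A (nbr A u) c∈
                  u≁c = λ u~c → x∈p─q⇒x∉q A (nbr A u) c∈ (∈nbr⁺ c∈A u~c)
              in no-path Mx Mv x≁v (c , c∈A , x~c , u≁c , v≁c) (b′ , b′∈B , v~b′ , u≁b′ , x≁b′))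

    module _ (t : Triple) (good : Triple.Good t)
             (min-good : ∀ s → Triple.Good s → ¬ nbr B (Triple.u s) ⊂ nbr B (Triple.u t))
             where
      open Triple t
      open Missed

      -- Missing `b`, such a `v` has N_B(v) strictly inside N_B(u), so by `min-good` no triple
      -- centred at `v` is good.
      K : Fin n → Set
      K v = Missed v × nbr B v ⊆ nbr B u

      -- a′ is chosen outside N(u) whenever possible.
      preferred-neighbour : ∀ {v} → HasNbr A v → ∃ λ a′ → a′ ∈ A × v ~ a′ × (¬ nbr A v ⊆ nbr A u → ¬ u ~ a′)
      preferred-neighbour {v} (a′ , a′∈A , v~a′) with any? (λ c → (c ∈? A) ×-dec (v ~? c) ×-dec ¬? (u ~? c))
      ... | yes (c , c∈A , v~c , u≁c) = c , c∈A , v~c , λ _ → u≁c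
      ... | no none = a′ , a′∈A , v~a′ , λ v⊈u → contradiction (nbr-⊈ v⊈u) none

      -- By minimality of t, v cannot be the centre of a good triple; the vertex x₀ refuting goodness
      -- then forces N_A(y) ⊊ N_A(v) for each vertex y missed by the eight vertices below.
      dominated-if-some-stay : ∃ K → Dominated 8 (TwoSided A B)
      dominated-if-some-stay K-inhabited none =
        minimal-exists ⊂-wellFounded (nbr A ∘ proj₁) K-inhabited λ ((v , Mv , v⊆u) , min) →
          let ((nbrA , _) , ((b″ , b″∈B , v~b″) , _)) = x∈Z Mv
              (a′ , a′∈A , v~a′ , outside-u) = preferred-neighbour nbrA
              s : Triple
              s = record { u∈Z = x∈Z Mv ; a∈A = a′∈A ; b∈B = b″∈B ; u~a = v~a′ ; u~b = v~b″ }
              module s = Triple s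
          in min-good s
            (λ x₀ Mx₀ x₀⊆v {b₀} b₀∈ → decidable-stable (b₀ ∈? nbr B v) λ b₀∉ →
              let (b₀∈B , x₀~b₀) = ∈nbr⁻ b₀∈
                  v≁b₀ = λ v~b₀ → b₀∉ (∈nbr⁺ b₀∈B v~b₀)
              in none (u ∷ a ∷ b ∷ v ∷ a′ ∷ b″ ∷ x₀ ∷ b₀ ∷ [] , ≤-refl , λ y y∈Z →
                decidable-stable (Any.any? (y ~?_) _) λ y≁ →
                  let y≁v  = y≁ ∘ there ∘ there ∘ there ∘ here
                      y≁a′ = y≁ ∘ there ∘ there ∘ there ∘ there ∘ here
                      y≁b″ = y≁ ∘ there ∘ there ∘ there ∘ there ∘ there ∘ here
                      y≁x₀ = y≁ ∘ there ∘ there ∘ there ∘ there ∘ there ∘ there ∘ here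
                      y≁b₀ = y≁ ∘ there ∘ there ∘ there ∘ there ∘ there ∘ there ∘ there ∘ here
                      My : Missed y
                      My = record { x∈Z = y∈Z ; x≁u = y≁ ∘ here ; x≁a = y≁ ∘ there ∘ here ; x≁b = y≁ ∘ there ∘ there ∘ here }
                      sMy : s.Missed y
                      sMy = record { x∈Z = y∈Z ; x≁u = y≁v ; x≁a = y≁a′ ; x≁b = y≁b″ }

                      -- Otherwise `y c a′ v b″ b₀ x₀` is an induced path.
                      y⊆v : nbr A y ⊆ nbr A v
                      y⊆v {c} c∈ = decidable-stable (c ∈? nbr A v) λ c∉ →
                        let (c∈A , y~c) = ∈nbr⁻ c∈ ; v≁c = λ v~c → c∉ (∈nbr⁺ c∈A v~c) in
                        s.no-path sMy Mx₀ y≁x₀ (c , c∈A , y~c , v≁c , λ x₀~c → c∉ (x₀⊆v (∈nbr⁺ c∈A x₀~c)))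
                                               (b₀ , b₀∈B , x₀~b₀ , v≁b₀ , y≁b₀)

                      -- Otherwise `y` is in `K` with N_A(y) strictly inside N_A(v), against the
                      -- choice of `v`.
                      y⊈u : ¬ nbr B y ⊆ nbr B u
                      y⊈u y⊆u = min (y , My , y⊆u) (nbr-⊂ y⊆v a′∈A v~a′ y≁a′)

                      (d , d∈B , y~d , u≁d) = nbr-⊈ y⊈u
                      -- N_A(v) is not inside N_A(u): else N_A(y) would be too, and goodness of `t`
                      -- would contradict `y⊈u`. The path is then `v a′ a u b d y`.
                      u≁a′ = outside-u λ v⊆u → y⊈u (good y My (v⊆u ∘ y⊆v))
                  in no-path Mv My (≁-sym y≁v) (a′ , a′∈A , v~a′ , u≁a′ , y≁a′)
                       (d , d∈B , y~d , u≁d , λ v~d → u≁d (proj₂ (∈nbr⁻ (v⊆u (∈nbr⁺ d∈B v~d)))))))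
            (nbr-⊂ v⊆u b∈B u~b (x≁b Mv))

    two-sided-dominated : Dominated 8 (TwoSided A B)
    two-sided-dominated = dominated-if-inhabited λ v v∈Z none →
      good-triple-exists v∈Z λ tg →
      minimal-exists ⊂-wellFounded (nbr B ∘ Triple.u ∘ proj₁) tg λ ((t , good) , min) →
      ¬¬-excluded-middle λ where
        (yes K-inhabited) → dominated-if-some-stay t good (λ s g → min (s , g)) K-inhabited none
        (no K-empty) → dominated-if-all-leave t good K-empty none

  -- Components and the final count

  component-⊆ : ∀ {S A B x} → IsComponent G S A → IsComponent G S B → x ∈ A → x ∈ B → A ⊆ B
  component-⊆ {A = A} {B} {x} cA cB x∈A x∈B {y} y∈A = decidable-stable (y ∈? B) λ y∉B →
    let (p , q , p∈B , q∈A , q∉B , p~q) = leaving-edge B (IsComponent.connected cA x y x∈A y∈A) x∈B y∉B y∈A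
    in q∉B (IsComponent.maximal cB p q p∈B p~q (IsComponent.avoidS cA q q∈A))

  -- By maximality an edge would put `b` into `A`, and components that meet coincide.
  components-anticomplete : ∀ {S A B} → IsComponent G S A → IsComponent G S B → ¬ A ≡ B → Anticomplete A B
  components-anticomplete cA cB A≢B {a} {b} a∈A b∈B a~b =
    A≢B (⊆-antisym (component-⊆ cA cB b∈A b∈B) (component-⊆ cB cA b∈B b∈A))
    where b∈A = IsComponent.maximal cA a b a∈A a~b (IsComponent.avoidS cB b b∈B)

  full⇒HasNbr : ∀ {S A v} → IsFullComponent G S A → v ∈ S → HasNbr A v
  full⇒HasNbr {v = v} fA v∈S with Equivalence.from (IsFullComponent.full fA v) v∈S
  ... | _ , a , a∈A , a~v = a , a∈A , sym G a~v

  separator-dominated : ∀ {S} → PFree 7 G → MinimalSeparator G S → Dominated 22 (_∈ S)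
  separator-dominated {S} P₇-free (A , B , fA , fB , A≢B) none =
    split-pair-exists (connected cA) (nonempty cA) λ (pA , qA , splitA) →
    split-pair-exists (connected cB) (nonempty cB) λ (pB , qB , splitB) →
    one-sided-dominated P₇-free A≁B λ (T₁ , ∣T₁∣ , dom₁) →
    one-sided-dominated P₇-free B≁A λ (T₂ , ∣T₂∣ , dom₂) →
    two-sided-dominated P₇-free A≁B λ (T₃ , ∣T₃∣ , dom₃) →
    none (pA ∷ qA ∷ pB ∷ qB ∷ T₁ ++ T₂ ++ T₃
      , s≤s (s≤s (s≤s (s≤s (≤-trans (≤-reflexive (trans (length-++ T₁) (cong (length T₁ +_) (length-++ T₂))))
                                    (+-mono-≤ ∣T₁∣ (+-mono-≤ ∣T₂∣ ∣T₃∣))))))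
      , λ v v∈S → decidable-stable (Any.any? (v ~?_) _) λ v≁ →
          let skip  = there ∘ there ∘ there ∘ there
              nA    = full⇒HasNbr fA v∈S
              nB    = full⇒HasNbr fB v∈S
              sA : ¬ TailP₄ A v → Split A v
              sA    = λ no-P₄ → splitA v nA no-P₄ (v≁ ∘ here) (v≁ ∘ there ∘ here)
              sB : ¬ TailP₄ B v → Split B v
              sB    = λ no-P₄ → splitB v nB no-P₄ (v≁ ∘ there ∘ there ∘ here) (v≁ ∘ there ∘ there ∘ there ∘ here)
          -- A tail into `A` excludes one into `B`, so `v` is split in `B` and falls to `T₂`. A tail
          -- into `B` alone leads to `T₁`, and no tail at all to `T₃`.
          in ¬¬-excluded-middle λ where
            (yes PA) → v≁ (skip (++⁺ʳ T₁ (++⁺ˡ (dom₂ v (nB , sB (not-both-tails P₇-free A≁B PA) , PA)))))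
            (no ¬PA) → ¬¬-excluded-middle λ where
              (yes PB) → v≁ (skip (++⁺ˡ (dom₁ v (nA , sA ¬PA , PB))))
              (no ¬PB) → v≁ (skip (++⁺ʳ T₁ (++⁺ʳ T₂ (dom₃ v ((nA , sA ¬PA) , (nB , sB ¬PB)))))))
    where
    open IsComponent
    cA = IsFullComponent.component fA
    cB = IsFullComponent.component fB
    A≁B = components-anticomplete cA cB A≢B
    B≁A = components-anticomplete cB cA (A≢B ∘ ≡-sym)

  InNClosed? : ∀ X v → Dec (InNClosed G X v)
  InNClosed? X v = (v ∈? X) ⊎-dec (¬? (v ∈? X) ×-dec any? λ u → (u ∈? X) ×-dec (u ~? v))

  dominates⇒InNClosed : ∀ {v} T → Dominates T v → InNClosed G (fromList T) v
  dominates⇒InNClosed {v} T dom with v ∈? fromList T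
  ... | yes v∈T = inj₁ v∈T
  ... | no v∉T with Any⇒∈fromList T dom
  ... | u , u∈T , v~u = inj₂ (v∉T , u , u∈T , sym G v~u)

theorem1p3 : ∀ {n} (G : Graph n) (S : Subset n) → PFree 7 G → MinimalSeparator G S → Σ (Subset n) (λ S′ → ∣ S′ ∣ ≤ 22 × (∀ v → v ∈ S → InNClosed G S′ v))
theorem1p3 G S P₇-free sep = decidable-stable
  (anySubset? λ S′ → (∣ S′ ∣ ≤? 22) ×-dec all? λ v → (v ∈? S) →-dec InNClosed? G S′ v)
  λ none → separator-dominated G P₇-free sep λ (T , ∣T∣≤22 , dom) →
    none (fromList T , ≤-trans (∣fromList∣≤length T) ∣T∣≤22 , λ v v∈S → dominates⇒InNClosed G T (dom v v∈S))
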